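{- Let $t\geq 3$ be an integer. Every subgraph of $C_n^k$ with minimum degree strictly exceeding $\left(2-\frac1{t-2}\right)k+1$ contains $K_t$ as a subgraph. Moreover, this bound is tight in the following sense: whenever $(t-2)\mid k$, $\frac{k}{t-2}\mid n$ and $n>2k+\frac{2k}{t-2}$, there exists a $K_t$-free subgraph of $C_n^k$ with minimum degree $\left(2-\frac1{t-2}\right)k+1$.
   Context: $C_n^k$ is the $k$th power of the cycle $C_n$ on $n$ vertices: two distinct vertices of $C_n$ are adjacent in $C_n^k$ if and only if their distance in $C_n$ is at most $k$. In the tightness statement the subgraph is spanning. -}

module Defs where

open import Data.Fin.Base using (Fin; toℕ)
open import Data.Fin.Properties using (toℕ<n)
open import Data.Fin.Subset using (Subset; _∈_; ∣_∣)
open import Data.Integer.Base using (+_)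
open import Data.Nat.Base using (ℕ; zero; suc; _≤_; _<_; _∸_; NonZero; >-nonZero; z≤n; s≤s)
open import Data.Nat.DivMod using (_%_; m<n⇒m%n≡m; n%n≡0)
open import Data.Nat.Properties using (m<n⇒0<n∸m; ≤-trans; ≤∧≢⇒<; 1+n≢n; _≟_)
open import Data.Product.Base using (∃-syntax; _×_; _,_)
open import Data.Rational.Base as ℚ using (ℚ)
open import Data.Sum.Base using (_⊎_; inj₁; inj₂; swap)
open import Data.Vec.Base using (tabulate)
open import Function.Definitions using (Injective)
open import Level using (0ℓ)
open import Relation.Binary.Core using (Rel)
open import Relation.Binary.Definitions using (Symmetric; Decidable)
open import Relation.Binary.PropositionalEquality using (_≡_; _≢_; refl; sym; trans)
open import Relation.Nullary using (¬_; does; yes; no)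

record Graph (n : ℕ) : Set₁ where
  field
    Adj    : Rel (Fin n) 0ℓ
    symm   : Symmetric Adj
    irrefl : ∀ {v} → ¬ Adj v v

open Graph

complete : ∀ t → Graph t
complete t = record
  { Adj    = _≢_
  ; symm   = λ i≢j j≡i → i≢j (sym j≡i)
  ; irrefl = λ v≢v → v≢v refl
  }

suc-%-≢ : ∀ {n m} .{{_ : NonZero n}} → 3 ≤ n → m < n → suc m % n ≢ m
suc-%-≢ {n} {m} 3≤n m<n eq with suc m ≟ n
... | no  1+m≢n = 1+n≢n (trans (sym (m<n⇒m%n≡m (≤∧≢⇒< m<n 1+m≢n))) eq)
... | yes refl with refl ← trans (sym eq) (n%n≡0 (suc m)) with s≤s () ← 3≤n

cycle : ∀ n → 3 ≤ n → Graph n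
cycle n 3≤n = record
  { Adj    = λ u v → (suc (toℕ u) % n ≡ toℕ v) ⊎ (suc (toℕ v) % n ≡ toℕ u)
  ; symm   = swap
  ; irrefl = λ { {v} (inj₁ eq) → suc-%-≢ 3≤n (toℕ<n v) eq
               ; {v} (inj₂ eq) → suc-%-≢ 3≤n (toℕ<n v) eq }
  }
  where instance
    n≢0 : NonZero n
    n≢0 = >-nonZero (≤-trans (s≤s z≤n) 3≤n)

module _ {n} (G : Graph n) where

  data Walk : Fin n → Fin n → ℕ → Set where
    []  : ∀ {v} → Walk v v zero
    _∷_ : ∀ {u v w d} → Adj G u v → Walk v w d → Walk u w (suc d)

  IsDistance : Fin n → Fin n → ℕ → Set
  IsDistance u v d = Walk u v d × (∀ d′ → Walk u v d′ → d ≤ d′)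

  _∷ʳ_ : ∀ {u v w d} → Walk u v d → Adj G v w → Walk u w (suc d)
  []      ∷ʳ e = e ∷ []
  (a ∷ p) ∷ʳ e = a ∷ (p ∷ʳ e)

  reverse : ∀ {u v d} → Walk u v d → Walk v u d
  reverse []      = []
  reverse (a ∷ p) = reverse p ∷ʳ symm G a

  power : ℕ → Graph n
  power k = record
    { Adj    = λ u v → u ≢ v × ∃[ d ] (IsDistance u v d × d ≤ k)
    ; symm   = λ { (u≢v , d , (p , min) , d≤k) →
                   (λ v≡u → u≢v (sym v≡u))
                 , d , (reverse p , λ d′ q → min d′ (reverse q)) , d≤k }
    ; irrefl = λ (v≢v , _) → v≢v refl
    }

-- Subgraphs need not be induced or spanning.  Adjacency is decidable so that
-- degrees can be counted.
record Subgraph {n} (G : Graph n) : Set₁ where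
  field
    vertices : Subset n
    Edge     : Rel (Fin n) 0ℓ
    edge?    : Decidable Edge
    symm     : Symmetric Edge
    endpoint : ∀ {u v} → Edge u v → u ∈ vertices
    edge⇒adj : ∀ {u v} → Edge u v → Adj G u v

module _ {n} {G : Graph n} (H : Subgraph G) where

  open Subgraph H using (vertices; Edge; edge?)

  neighbours : Fin n → Subset n
  neighbours v = tabulate (λ u → does (edge? v u))

  degree : Fin n → ℕ
  degree v = ∣ neighbours v ∣

  -- A subgraph without vertices has no minimum degree.
  IsMinDegree : ℕ → Set
  IsMinDegree δ = (∃[ v ] (v ∈ vertices × degree v ≡ δ))
                × (∀ v → v ∈ vertices → δ ≤ degree v)

  Spanning : Set
  Spanning = ∀ v → v ∈ vertices

  -- Not necessarily induced copies.
  Contains : ∀ {m} → Graph m → Set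
  Contains {m} F = ∃[ f ] ( Injective _≡_ _≡_ f
                          × (∀ (i : Fin m) → f i ∈ vertices)
                          × (∀ i j → Adj F i j → Edge (f i) (f j)))

t∸2≢0 : ∀ {t} → 3 ≤ t → NonZero (t ∸ 2)
t∸2≢0 3≤t = >-nonZero (m<n⇒0<n∸m 3≤t)

fromℕ : ℕ → ℚ
fromℕ m = + m ℚ./ 1

degreeBound : (t k : ℕ) .{{_ : NonZero (t ∸ 2)}} → ℚ
degreeBound t k = (fromℕ 2 ℚ.- + 1 ℚ./ (t ∸ 2)) ℚ.* fromℕ k ℚ.+ fromℕ 1

{-# OPTIONS --safe #-}

-- Existence: let v maximise the number of neighbours among v + 1, …, v + k, and let w be the
-- furthest of them.  Then right-degree of v + left-degree of w ≥ right-degree of w + left-degree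
-- of w ≥ δ, so v and w have at least δ − k − 1 common neighbours between them.  A ball of radius k
-- has 2k + 1 vertices, so each vertex there misses at most 2k + 1 − δ of these, itself included,
-- and a greedy choice finds K_{t−2} among them.
--
-- Tightness: with q = k / (t − 2), cut the cycle into blocks of q consecutive vertices and delete
-- the edges inside blocks.  A clique meets each block at most once, and in the cycle of blocks its
-- members are within distance t − 2, which bounds its size by t − 1.  Each degree is at least
-- 2k + 1 − q; the minimum is no larger because of the existence part.
module Submission where

open import Data.Bool.Base using (true; false)
open import Data.Fin.Base as Fin using (Fin; zero; suc; toℕ)
open import Data.Fin.Properties as Fin using (toℕ<n; toℕ-fromℕ<; toℕ-injective)
open import Data.Fin.Subset using (Subset; _∈_; _∉_; _⊆_; ∣_∣; _∪_; _∩_; ⊥; ⊤; ⁅_⁆; Nonempty)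
open import Data.Fin.Subset.Properties
import Data.Integer.Base as ℤ
import Data.Integer.Properties as ℤ
open import Data.List.Base using (allFin)
open import Data.List.Extrema.Nat using (argmax; argmin; f[xs]≤f[argmax]; f[argmin]≤f[xs])
open import Data.List.Membership.Propositional.Properties using (∈-allFin)
import Data.List.Relation.Unary.All as All
open import Data.Nat.Base
open import Data.Nat.Divisibility using (_∣_; divides)
open import Data.Nat.DivMod
open import Data.Nat.Properties
open import Data.Nat.Tactic.RingSolver using (solve-∀)
open import Data.Product.Base
open import Data.Rational.Base as ℚ using (ℚ)
import Data.Rational.Properties as ℚ
open import Data.Rational.Solver using (module +-*-Solver)
open import Data.Rational.Unnormalised.Base as ℚᵘ using (mkℚᵘ)
import Data.Rational.Unnormalised.Properties as ℚᵘ
open import Data.Sum.Base as Sum using (_⊎_; inj₁; inj₂)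
open import Data.Vec.Base using ([]; _∷_)
open import Data.Vec.Properties using ([]=⇒lookup; lookup⇒[]=; lookup∘tabulate)
open import Function.Base using (_∘_)
open import Function.Definitions using (Injective)
open import Relation.Binary.Definitions using (tri<; tri≈; tri>)
open import Relation.Binary.PropositionalEquality
open import Relation.Nullary using (¬_; Dec; does; yes; no; contradiction)
open import Relation.Nullary.Decidable
  using (dec-true; map′; _×-dec_; _⊎-dec_; ¬?; decidable-stable)
open import Relation.Unary using (Decidable)
open import Defs

-- Subsets of Fin n

∣p∪q∣+∣p∩q∣≡∣p∣+∣q∣ : ∀ {n} (p q : Subset n) → ∣ p ∪ q ∣ + ∣ p ∩ q ∣ ≡ ∣ p ∣ + ∣ q ∣
∣p∪q∣+∣p∩q∣≡∣p∣+∣q∣ []          []          = refl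
∣p∪q∣+∣p∩q∣≡∣p∣+∣q∣ (true  ∷ p) (true  ∷ q) = cong suc (trans (+-suc _ _)
  (trans (cong suc (∣p∪q∣+∣p∩q∣≡∣p∣+∣q∣ p q)) (sym (+-suc _ _))))
∣p∪q∣+∣p∩q∣≡∣p∣+∣q∣ (true  ∷ p) (false ∷ q) = cong suc (∣p∪q∣+∣p∩q∣≡∣p∣+∣q∣ p q)
∣p∪q∣+∣p∩q∣≡∣p∣+∣q∣ (false ∷ p) (true  ∷ q) =
  trans (cong suc (∣p∪q∣+∣p∩q∣≡∣p∣+∣q∣ p q)) (sym (+-suc _ _))
∣p∪q∣+∣p∩q∣≡∣p∣+∣q∣ (false ∷ p) (false ∷ q) = ∣p∪q∣+∣p∩q∣≡∣p∣+∣q∣ p q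

∣p∪q∣≤∣p∣+∣q∣ : ∀ {n} (p q : Subset n) → ∣ p ∪ q ∣ ≤ ∣ p ∣ + ∣ q ∣
∣p∪q∣≤∣p∣+∣q∣ p q = subst (∣ p ∪ q ∣ ≤_) (∣p∪q∣+∣p∩q∣≡∣p∣+∣q∣ p q) (m≤m+n _ _)

0<∣p∣⇒Nonempty : ∀ {n} (p : Subset n) → 0 < ∣ p ∣ → Nonempty p
0<∣p∣⇒Nonempty {n} p 0<∣p∣ with nonempty? p
... | yes ne = ne
... | no  ¬ne with refl ← Empty-unique ¬ne = contradiction (sym (∣⊥∣≡0 n)) (<⇒≢ 0<∣p∣)

x∉p⇒∣⁅x⁆∪p∣≡1+∣p∣ : ∀ {n} {x : Fin n} (p : Subset n) → x ∉ p → ∣ ⁅ x ⁆ ∪ p ∣ ≡ suc ∣ p ∣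
x∉p⇒∣⁅x⁆∪p∣≡1+∣p∣ {n} {x} p x∉p = begin
  ∣ ⁅ x ⁆ ∪ p ∣                  ≡⟨ +-identityʳ _ ⟨
  ∣ ⁅ x ⁆ ∪ p ∣ + 0
    ≡⟨ cong (∣ ⁅ x ⁆ ∪ p ∣ +_) (trans (cong ∣_∣ (Empty-unique disjoint)) (∣⊥∣≡0 n)) ⟨
  ∣ ⁅ x ⁆ ∪ p ∣ + ∣ ⁅ x ⁆ ∩ p ∣  ≡⟨ ∣p∪q∣+∣p∩q∣≡∣p∣+∣q∣ ⁅ x ⁆ p ⟩
  ∣ ⁅ x ⁆ ∣ + ∣ p ∣              ≡⟨ cong (_+ ∣ p ∣) (∣⁅x⁆∣≡1 x) ⟩
  suc ∣ p ∣                      ∎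
  where
  open ≡-Reasoning
  disjoint : ¬ Nonempty (⁅ x ⁆ ∩ p)
  disjoint (y , y∈) with y∈x , y∈p ← x∈p∩q⁻ ⁅ x ⁆ p y∈ with refl ← x∈⁅y⁆⇒x≡y x y∈x = x∉p y∈p

module _ {n} (f : ℕ → Fin n) where

  -- Arcs, balls and blocks all take this form. An arc that wraps around lists a vertex more than
  -- once; the union of singletons absorbs this, so `∣image∣≤` holds for every `f`.
  image : ℕ → Subset n
  image zero    = ⊥
  image (suc ℓ) = ⁅ f ℓ ⁆ ∪ image ℓ

  ∈-image⁺ : ∀ {i ℓ} → i < ℓ → f i ∈ image ℓ
  ∈-image⁺ {i} {suc ℓ} i<1+ℓ with i ≟ ℓ
  ... | yes refl = x∈p∪q⁺ (inj₁ (x∈⁅x⁆ (f ℓ)))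
  ... | no  i≢ℓ  = x∈p∪q⁺ (inj₂ (∈-image⁺ (≤∧≢⇒< (s≤s⁻¹ i<1+ℓ) i≢ℓ)))

  ∈-image⁻ : ∀ {x} ℓ → x ∈ image ℓ → ∃[ i ] (i < ℓ × x ≡ f i)
  ∈-image⁻ zero    x∈ = contradiction x∈ ∉⊥
  ∈-image⁻ (suc ℓ) x∈ with x∈p∪q⁻ ⁅ f ℓ ⁆ (image ℓ) x∈
  ... | inj₁ x∈ₗ = ℓ , n<1+n ℓ , x∈⁅y⁆⇒x≡y (f ℓ) x∈ₗ
  ... | inj₂ x∈ᵣ = map₂ (map₁ m<n⇒m<1+n) (∈-image⁻ ℓ x∈ᵣ)

  ∣image∣≤ : ∀ ℓ → ∣ image ℓ ∣ ≤ ℓ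
  ∣image∣≤ zero    = ≤-reflexive (∣⊥∣≡0 n)
  ∣image∣≤ (suc ℓ) = ≤-trans (∣p∪q∣≤∣p∣+∣q∣ ⁅ f ℓ ⁆ (image ℓ))
    (+-mono-≤ (≤-reflexive (∣⁅x⁆∣≡1 (f ℓ))) (∣image∣≤ ℓ))

  ∣image∣≡ : ∀ ℓ → (∀ {i j} → i < j → j < ℓ → f i ≢ f j) → ∣ image ℓ ∣ ≡ ℓ
  ∣image∣≡ zero    _   = ∣⊥∣≡0 n
  ∣image∣≡ (suc ℓ) inj = trans (x∉p⇒∣⁅x⁆∪p∣≡1+∣p∣ (image ℓ) fℓ∉)
    (cong suc (∣image∣≡ ℓ λ i<j j<ℓ → inj i<j (m<n⇒m<1+n j<ℓ)))
    where
    fℓ∉ : f ℓ ∉ image ℓ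
    fℓ∉ fℓ∈ with i , i<ℓ , eq ← ∈-image⁻ ℓ fℓ∈ = inj i<ℓ (n<1+n ℓ) (sym eq)

-- The cyclic group of order n acting on Fin n

module Rotation {n} .{{_ : NonZero n}} where

  infixl 6 _⊕_ _⊖_

  _⊕_ : Fin n → ℕ → Fin n
  u ⊕ i = (toℕ u + i) mod n

  -- `pred n` is -1 modulo `n`, so stepping back is itself a rotation and no truncated subtraction
  -- occurs.
  _⊖_ : Fin n → ℕ → Fin n
  u ⊖ i = u ⊕ (i * pred n)

  toℕ-⊕ : ∀ u i → toℕ (u ⊕ i) ≡ (toℕ u + i) % n
  toℕ-⊕ u i = toℕ-fromℕ< _

  [m%n+o]%n≡[m+o]%n : ∀ m o → (m % n + o) % n ≡ (m + o) % n
  [m%n+o]%n≡[m+o]%n m o = begin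
    (m % n + o) % n          ≡⟨ %-distribˡ-+ (m % n) o n ⟩
    (m % n % n + o % n) % n  ≡⟨ cong (λ x → (x + o % n) % n) (m%n%n≡m%n m n) ⟩
    (m % n + o % n) % n      ≡⟨ %-distribˡ-+ m o n ⟨
    (m + o) % n              ∎
    where open ≡-Reasoning

  ⊕-assoc : ∀ u i j → u ⊕ i ⊕ j ≡ u ⊕ (i + j)
  ⊕-assoc u i j = toℕ-injective (begin
    toℕ (u ⊕ i ⊕ j)            ≡⟨ toℕ-⊕ (u ⊕ i) j ⟩
    (toℕ (u ⊕ i) + j) % n      ≡⟨ cong (λ x → (x + j) % n) (toℕ-⊕ u i) ⟩
    ((toℕ u + i) % n + j) % n  ≡⟨ [m%n+o]%n≡[m+o]%n (toℕ u + i) j ⟩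
    (toℕ u + i + j) % n        ≡⟨ cong (_% n) (+-assoc (toℕ u) i j) ⟩
    (toℕ u + (i + j)) % n      ≡⟨ toℕ-⊕ u (i + j) ⟨
    toℕ (u ⊕ (i + j))          ∎)
    where open ≡-Reasoning

  ⊕-*-identity : ∀ u i → u ⊕ (i * n) ≡ u
  ⊕-*-identity u i = toℕ-injective (begin
    toℕ (u ⊕ (i * n))      ≡⟨ toℕ-⊕ u (i * n) ⟩
    (toℕ u + i * n) % n    ≡⟨ [m+kn]%n≡m%n (toℕ u) i n ⟩
    toℕ u % n              ≡⟨ m<n⇒m%n≡m (toℕ<n u) ⟩
    toℕ u                  ∎)
    where open ≡-Reasoning

  ⊕-identityʳ : ∀ u → u ⊕ 0 ≡ u
  ⊕-identityʳ u = ⊕-*-identity u 0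

  ⊕-⊖ : ∀ u i → u ⊕ i ⊖ i ≡ u
  ⊕-⊖ u i = begin
    u ⊕ i ⊕ (i * pred n)    ≡⟨ ⊕-assoc u i _ ⟩
    u ⊕ (i + i * pred n)    ≡⟨ cong (u ⊕_) (*-suc i (pred n)) ⟨
    u ⊕ (i * suc (pred n))  ≡⟨ cong (λ m → u ⊕ (i * m)) (suc-pred n) ⟩
    u ⊕ (i * n)             ≡⟨ ⊕-*-identity u i ⟩
    u                       ∎
    where open ≡-Reasoning

  ⊖-⊕ : ∀ u i → u ⊖ i ⊕ i ≡ u
  ⊖-⊕ u i = begin
    u ⊕ (i * pred n) ⊕ i  ≡⟨ ⊕-assoc u _ i ⟩
    u ⊕ (i * pred n + i)  ≡⟨ cong (u ⊕_) (+-comm (i * pred n) i) ⟩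
    u ⊕ (i + i * pred n)  ≡⟨ ⊕-assoc u i _ ⟨
    u ⊕ i ⊖ i             ≡⟨ ⊕-⊖ u i ⟩
    u                     ∎
    where open ≡-Reasoning

  ⊕-injective : ∀ {u v} i → u ⊕ i ≡ v ⊕ i → u ≡ v
  ⊕-injective {u} {v} i eq = trans (sym (⊕-⊖ u i)) (trans (cong (_⊖ i) eq) (⊕-⊖ v i))

  ⊕-⊕1 : ∀ u i → u ⊕ i ⊕ 1 ≡ u ⊕ suc i
  ⊕-⊕1 u i = trans (⊕-assoc u i 1) (cong (u ⊕_) (+-comm i 1))

  ⊕-∸ : ∀ u {i j} → i ≤ j → u ⊕ i ⊕ (j ∸ i) ≡ u ⊕ j
  ⊕-∸ u {i} {j} i≤j = trans (⊕-assoc u i (j ∸ i)) (cong (u ⊕_) (m+[n∸m]≡n i≤j))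

  ⊕-∸′ : ∀ u {i j} → i ≤ j → u ⊕ (j ∸ i) ⊕ i ≡ u ⊕ j
  ⊕-∸′ u {i} {j} i≤j = trans (⊕-assoc u (j ∸ i) i) (cong (u ⊕_) (m∸n+n≡m i≤j))

  ⊕-free : ∀ u {i} → 0 < i → i < n → u ⊕ i ≢ u
  ⊕-free u {i} 0<i i<n eq with toℕ u + i <? n
  ... | yes u+i<n = <⇒≢ (m<m+n (toℕ u) 0<i)
    (trans (cong toℕ (sym eq)) (trans (toℕ-⊕ u i) (m<n⇒m%n≡m u+i<n)))
  -- Past the wrap-around the residue is `toℕ u + i ∸ n`, so equality with `toℕ u` would force `i`
  -- to be `n`.
  ... | no  u+i≮n = <⇒≢ i<n (+-cancelˡ-≡ (toℕ u) i n (begin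
    toℕ u + i                  ≡⟨ m∸n+n≡m n≤u+i ⟨
    toℕ u + i ∸ n + n          ≡⟨ cong (_+ n) (m<n⇒m%n≡m u+i∸n<n) ⟨
    (toℕ u + i ∸ n) % n + n    ≡⟨ cong (_+ n) (m≤n⇒[n∸m]%m≡n%m n≤u+i) ⟩
    (toℕ u + i) % n + n        ≡⟨ cong (_+ n) (toℕ-⊕ u i) ⟨
    toℕ (u ⊕ i) + n            ≡⟨ cong (λ v → toℕ v + n) eq ⟩
    toℕ u + n                  ∎))
    where
    open ≡-Reasoning
    n≤u+i : n ≤ toℕ u + i
    n≤u+i = ≮⇒≥ u+i≮n
    u+i∸n<n : toℕ u + i ∸ n < n
    u+i∸n<n = +-cancelʳ-< n _ n (subst (_< n + n) (sym (m∸n+n≡m n≤u+i)) (+-mono-< (toℕ<n u) i<n))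

  ⊕-cancelˡ-≢ : ∀ u {i j} → i < j → j < n → u ⊕ i ≢ u ⊕ j
  ⊕-cancelˡ-≢ u {i} {j} i<j j<n eq =
    ⊕-free (u ⊕ i) (m<n⇒0<n∸m i<j) (≤-<-trans (m∸n≤m j i) j<n) (trans (⊕-∸ u (<⇒≤ i<j)) (sym eq))

  Within : ℕ → Fin n → Fin n → Set
  Within k u v = ∃[ i ] (i ≤ k × (v ≡ u ⊕ i ⊎ u ≡ v ⊕ i))

  -- The arc starts at `u ⊖ k`, which puts the centre `u` at index `k` of the 2k + 1 indices.
  ball : ℕ → Fin n → Subset n
  ball k u = image (u ⊖ k ⊕_) (suc (2 * k))

  ∈-ball⁺ : ∀ {k u v} → Within k u v → v ∈ ball k u
  ∈-ball⁺ {k} {u} (i , i≤k , inj₁ refl) =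
    subst (_∈ ball k u) (trans (sym (⊕-assoc (u ⊖ k) k i)) (cong (_⊕ i) (⊖-⊕ u k)))
      (∈-image⁺ (u ⊖ k ⊕_) {k + i} (s≤s (+-monoʳ-≤ k (≤-trans i≤k (m≤m+n k 0)))))
  ∈-ball⁺ {k} {u} {v} (i , i≤k , inj₂ u≡v⊕i) =
    subst (_∈ ball k u) (⊕-injective i (trans (⊕-∸′ (u ⊖ k) i≤k) (trans (⊖-⊕ u k) u≡v⊕i)))
      (∈-image⁺ (u ⊖ k ⊕_) {k ∸ i} (s≤s (≤-trans (m∸n≤m k i) (m≤m+n k _))))

  ∈-ball⁻ : ∀ {k u v} → v ∈ ball k u → Within k u v
  ∈-ball⁻ {k} {u} v∈ with ∈-image⁻ (u ⊖ k ⊕_) (suc (2 * k)) v∈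
  ... | i , i≤2k , refl with ≤-total k i
  ...   | inj₁ k≤i = i ∸ k , subst (i ∸ k ≤_) (trans (m+n∸m≡n k (k + 0)) (+-identityʳ k))
                               (∸-monoˡ-≤ k (s≤s⁻¹ i≤2k))
                   , inj₁ (trans (sym (⊕-∸ (u ⊖ k) k≤i)) (cong (_⊕ (i ∸ k)) (⊖-⊕ u k)))
  ...   | inj₂ i≤k = k ∸ i , m∸n≤m k i , inj₂ (sym (trans (⊕-∸ (u ⊖ k) i≤k) (⊖-⊕ u k)))

  ∣ball∣≤ : ∀ k u → ∣ ball k u ∣ ≤ suc (2 * k)
  ∣ball∣≤ k u = ∣image∣≤ (u ⊖ k ⊕_) (suc (2 * k))

  ∣ball∣≡ : ∀ k u → 2 * k < n → ∣ ball k u ∣ ≡ suc (2 * k)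
  ∣ball∣≡ k u 2k<n = ∣image∣≡ (u ⊖ k ⊕_) (suc (2 * k))
    λ i<j j≤2k → ⊕-cancelˡ-≢ (u ⊖ k) i<j (≤-<-trans (s≤s⁻¹ j≤2k) 2k<n)

  Within-sym : ∀ {k u v} → Within k u v → Within k v u
  Within-sym (i , i≤k , rotated) = i , i≤k , Sum.swap rotated

  -- Forward offsets below `n` lead to distinct vertices, so k + 1 differs from all of 0, ..., k.
  -- Backward, a further i ≤ k steps would close a circuit of length between 1 and 2k + 1, which is
  -- less than `n`.
  ¬Within-⊕ : ∀ {k u} → 2 * k + 1 < n → ¬ Within k u (u ⊕ suc k)
  ¬Within-⊕ {k} {u} 2k+1<n (i , i≤k , inj₁ eq) =
    ⊕-cancelˡ-≢ u (s≤s i≤k) (≤-<-trans (subst (suc k ≤_) (+-comm 1 (2 * k)) (s≤s (m≤m+n k _))) 2k+1<n) (sym eq)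
  ¬Within-⊕ {k} {u} 2k+1<n (i , i≤k , inj₂ eq) = ⊕-free u (s≤s z≤n) (begin-strict
    suc k + i        ≤⟨ +-monoʳ-≤ (suc k) i≤k ⟩
    suc k + k        ≡⟨ rearrange k ⟩
    2 * k + 1        <⟨ 2k+1<n ⟩
    n                ∎) (sym (trans eq (⊕-assoc u (suc k) i)))
    where
    open ≤-Reasoning
    rearrange : ∀ k → suc k + k ≡ 2 * k + 1
    rearrange = solve-∀

  -- Within distance k of u, the vertices u + (j + 1) and u - (k - j) share the slot j;
  -- they are k + 1 steps apart.
  Slot : (k : ℕ) → Fin n → Fin n → Fin k → Set
  Slot k u v j = v ≡ u ⊕ suc (toℕ j) ⊎ u ≡ v ⊕ (k ∸ toℕ j)

  slot : ∀ {k u v} → u ≢ v → Within k u v → ∃[ j ] Slot k u v j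
  slot {u = u} u≢v (zero  , _   , inj₁ eq) = contradiction (sym (trans eq (⊕-identityʳ u))) u≢v
  slot {v = v} u≢v (zero  , _   , inj₂ eq) = contradiction (trans eq (⊕-identityʳ v)) u≢v
  slot {u = u} u≢v (suc i , i<k , inj₁ eq) =
    Fin.fromℕ< i<k , inj₁ (trans eq (cong (λ j → u ⊕ suc j) (sym (toℕ-fromℕ< i<k))))
  slot {k} {v = v} u≢v (suc i , i<k , inj₂ eq) = Fin.fromℕ< k∸1+i<k , inj₂ (trans eq (cong (v ⊕_)
    (sym (trans (cong (k ∸_) (toℕ-fromℕ< k∸1+i<k)) (m∸[m∸n]≡n i<k)))))
    where
    k∸1+i<k : k ∸ suc i < k
    k∸1+i<k = ∸-monoʳ-< {o = 0} (s≤s z≤n) i<k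

  opposite : ∀ {k} (j : Fin k) v → v ⊕ (k ∸ toℕ j) ⊕ suc (toℕ j) ≡ v ⊕ suc k
  opposite {k} j v = trans (⊕-assoc v _ _)
    (cong (v ⊕_) (trans (+-suc _ _) (cong suc (m∸n+n≡m (<⇒≤ (toℕ<n j))))))

  slot-injective : ∀ {k u v w j} → 2 * k + 1 < n → Within k v w → Slot k u v j → Slot k u w j → v ≡ w
  slot-injective _ _ (inj₁ v≡) (inj₁ w≡) = trans v≡ (sym w≡)
  slot-injective _ _ (inj₂ u≡v⊕) (inj₂ u≡w⊕) = ⊕-injective _ (trans (sym u≡v⊕) u≡w⊕)
  slot-injective {k} {w = w} {j} 2k+1<n near (inj₁ refl) (inj₂ refl) =
    contradiction (subst (Within k w) (opposite j w) (Within-sym near)) (¬Within-⊕ 2k+1<n)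
  slot-injective {k} {v = v} {j = j} 2k+1<n near (inj₂ refl) (inj₁ refl) =
    contradiction (subst (Within k v) (opposite j v) near) (¬Within-⊕ 2k+1<n)

  -- Pigeonhole: each of the `m` members other than `f zero` takes one of the `k` slots around it.
  -- Two members in one slot would coincide or lie k + 1 steps apart, and a clique allows neither.
  ∣clique∣≤1+k : ∀ {m k} → 2 * k + 1 < n → (f : Fin (suc m) → Fin n) →
                 (∀ i j → i ≢ j → f i ≢ f j × Within k (f i) (f j)) → m ≤ k
  ∣clique∣≤1+k {m} {k} 2k+1<n f clique = Fin.injective⇒≤ {f = proj₁ ∘ slots} slots-injective
    where
    slots : ∀ i → ∃[ j ] Slot k (f zero) (f (suc i)) j
    slots i = slot (proj₁ (clique zero (suc i) λ ())) (proj₂ (clique zero (suc i) λ ()))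
    slots-injective : ∀ {i j} → proj₁ (slots i) ≡ proj₁ (slots j) → i ≡ j
    slots-injective {i} {j} eq with i Fin.≟ j
    ... | yes i≡j = i≡j
    ... | no  i≢j with f≢ , near ← clique (suc i) (suc j) (i≢j ∘ Fin.suc-injective) =
      contradiction (slot-injective 2k+1<n near (proj₂ (slots i))
        (subst (Slot k (f zero) (f (suc j))) (sym eq) (proj₂ (slots j)))) f≢

-- Extremal elements by finite search

least : ∀ {P : ℕ → Set} → Decidable P → ∀ m → P m → ∃[ d ] (d ≤ m × P d × (∀ e → P e → d ≤ e))
least P? zero    p = zero , z≤n , p , λ _ _ → z≤n
least {P} P? (suc m) p with P? zero
... | yes p₀ = zero , z≤n , p₀ , λ _ _ → z≤n
... | no ¬p₀ with d , d≤m , pd , min ← least (P? ∘ suc) m p = suc d , s≤s d≤m , pd , min′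
  where
  min′ : ∀ e → P e → suc d ≤ e
  min′ zero    pe = contradiction pe ¬p₀
  min′ (suc e) pe = s≤s (min e pe)

greatest : ∀ {P : ℕ → Set} → Decidable P → ∀ k → (∃[ i ] (i < k × P i)) →
           ∃[ d ] (d < k × P d × (∀ {i} → i < k → P i → i ≤ d))
greatest {P} P? (suc k) (i , i<1+k , pi) with P? k
... | yes pk = k , n<1+n k , pk , λ j<1+k _ → s≤s⁻¹ j<1+k
... | no ¬pk = extend (greatest P? k (i , below i<1+k pi , pi))
  where
  below : ∀ {j} → j < suc k → P j → j < k
  below j<1+k pj = ≤∧≢⇒< (s≤s⁻¹ j<1+k) λ { refl → ¬pk pj }
  extend : ∃[ d ] (d < k × P d × (∀ {j} → j < k → P j → j ≤ d)) →
           ∃[ d ] (d < suc k × P d × (∀ {j} → j < suc k → P j → j ≤ d))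
  extend (d , d<k , pd , max) = d , m<n⇒m<1+n d<k , pd , λ j<1+k pj → max (below j<1+k pj) pj

maximiser : ∀ {n} (f : Fin n → ℕ) → Fin n → ∃[ v ] (∀ u → f u ≤ f v)
maximiser f v₀ = argmax f v₀ (allFin _) 
  , λ u → All.lookup (f[xs]≤f[argmax] {f = f} v₀ (allFin _)) (∈-allFin u)

minimiser : ∀ {n} (f : Fin n → ℕ) → Fin n → ∃[ v ] (∀ u → f v ≤ f u)
minimiser f v₀ = argmin f v₀ (allFin _) 
  , λ u → All.lookup (f[argmin]≤f[xs] {f = f} v₀ (allFin _)) (∈-allFin u)

-- Cliques and powers of cycles

module _ {n} {G : Graph n} (H : Subgraph G) where
  open Subgraph H

  private N = neighbours H

  ∈-neighbours⁺ : ∀ {u v} → Edge u v → v ∈ N u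
  ∈-neighbours⁺ {u} {v} e = lookup⇒[]= v _ (trans (lookup∘tabulate _ v) (dec-true (edge? u v) e))

  ∈-neighbours⁻ : ∀ {u v} → v ∈ N u → Edge u v
  ∈-neighbours⁻ {u} {v} v∈
    with edge? u v | trans (sym (lookup∘tabulate (λ w → does (edge? u w)) v)) ([]=⇒lookup v∈)
  ... | yes e | _  = e
  ... | no _  | ()

  edge⇒≢ : ∀ {u v} → Edge u v → u ≢ v
  edge⇒≢ e refl = Graph.irrefl G (edge⇒adj e)

  Clique : ℕ → Subset n → Set
  Clique m A = Σ[ f ∈ (Fin m → Fin n) ] ((∀ i → f i ∈ A) × (∀ i j → i ≢ j → Edge (f i) (f j)))

  clique-extend : ∀ {m u A B} → u ∈ B → A ⊆ B → A ⊆ N u → Clique m A → Clique (suc m) B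
  clique-extend {m} {u} {A} {B} u∈B A⊆B A⊆N (f , f∈A , f-edge) = g , g∈B , g-edge
    where
    g : Fin (suc m) → Fin n
    g zero    = u
    g (suc i) = f i
    g∈B : ∀ i → g i ∈ B
    g∈B zero    = u∈B
    g∈B (suc i) = A⊆B (f∈A i)
    g-edge : ∀ i j → i ≢ j → Edge (g i) (g j)
    g-edge zero    zero    0≢0 = contradiction refl 0≢0
    g-edge zero    (suc j) _   = ∈-neighbours⁻ (A⊆N (f∈A j))
    g-edge (suc i) zero    _   = symm (∈-neighbours⁻ (A⊆N (f∈A i)))
    g-edge (suc i) (suc j) i≢j = f-edge i j (i≢j ∘ cong suc)

  clique⇒contains : ∀ {m} → Clique m vertices → Contains H (complete m)
  clique⇒contains (f , f∈ , f-edge) = f , f-injective , f∈ , f-edge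
    where
    f-injective : Injective _≡_ _≡_ f
    f-injective {i} {j} fi≡fj = decidable-stable (i Fin.≟ j) λ i≢j → edge⇒≢ (f-edge i j i≢j) fi≡fj

  -- By inclusion-exclusion, `sparse` says that each `u` in `A` misses at most `c` members of `A`,
  -- itself included. The hypothesis passes to `A ∩ N u`, so every choice costs at most `c`
  -- candidates, and more than `r * c` candidates leave room for `suc r` choices.
  greedy-clique : ∀ r c A → (∀ {u} → u ∈ A → ∣ A ∪ N u ∣ ≤ c + degree H u) → r * c < ∣ A ∣ → Clique (suc r) A
  greedy-clique r c A sparse rc<∣A∣ with u , u∈A ← 0<∣p∣⇒Nonempty A (≤-<-trans z≤n rc<∣A∣) = go r rc<∣A∣
    where
    A∩N = A ∩ N u
    ∣A∣≤c+∣A∩N∣ : ∣ A ∣ ≤ c + ∣ A∩N ∣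
    ∣A∣≤c+∣A∩N∣ = +-cancelʳ-≤ (degree H u) _ _ (begin
      ∣ A ∣ + degree H u            ≡⟨ ∣p∪q∣+∣p∩q∣≡∣p∣+∣q∣ A (N u) ⟨
      ∣ A ∪ N u ∣ + ∣ A∩N ∣         ≤⟨ +-monoˡ-≤ ∣ A∩N ∣ (sparse u∈A) ⟩
      c + degree H u + ∣ A∩N ∣      ≡⟨ +-assoc c _ _ ⟩
      c + (degree H u + ∣ A∩N ∣)    ≡⟨ cong (c +_) (+-comm (degree H u) _) ⟩
      c + (∣ A∩N ∣ + degree H u)    ≡⟨ +-assoc c _ _ ⟨
      c + ∣ A∩N ∣ + degree H u      ∎)
      where open ≤-Reasoning
    go : ∀ r → r * c < ∣ A ∣ → Clique (suc r) A
    go zero    _ = clique-extend u∈A (λ x∈ → contradiction x∈ ∉⊥) (λ x∈ → contradiction x∈ ∉⊥)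
      ((λ ()) , (λ ()) , (λ ()))
    go (suc r) lt = clique-extend u∈A (p∩q⊆p A (N u)) (p∩q⊆q A (N u))
      (greedy-clique r c A∩N
        (λ {x} x∈ → ≤-trans (p⊆q⇒∣p∣≤∣q∣ (λ y∈ → x∈p∪q⁺ (Sum.map₁ (p∩q⊆p A (N u)) (x∈p∪q⁻ A∩N (N x) y∈))))
                            (sparse (p∩q⊆p A (N u) x∈)))
        (+-cancelˡ-< c _ _ (<-≤-trans lt ∣A∣≤c+∣A∩N∣)))

-- Adjacency in powers, through walks and rotations

module _ {n} (G : Graph n) (adj? : ∀ u v → Dec (Graph.Adj G u v)) where

  walk? : ∀ u v d → Dec (Walk G u v d)
  walk? u v zero    = map′ (λ { refl → [] }) (λ { [] → refl }) (u Fin.≟ v)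
  walk? u v (suc d) = map′ (λ (w , a , p) → a ∷ p) (λ { (a ∷ p) → _ , a , p })
                           (Fin.any? λ w → adj? u w ×-dec walk? w v d)

  -- `power` asks for the exact distance; searching the lengths up to `d` replaces the given walk by
  -- a shortest one.
  walk⇒adj-power : ∀ {k u v d} → u ≢ v → Walk G u v d → d ≤ k → Graph.Adj (power G k) u v
  walk⇒adj-power {u = u} {v} {d} u≢v p d≤k
    with d′ , d′≤d , q , min ← least (walk? u v) d p = u≢v , d′ , (q , min) , ≤-trans d′≤d d≤k

module _ {n} (3≤n : 3 ≤ n) where

  private
    C = cycle n 3≤n

    instance
      n-nonZero : NonZero n
      n-nonZero = >-nonZero (≤-trans (s≤s z≤n) 3≤n)

  open Rotation {n}

  ⊕1 : ∀ u → toℕ (u ⊕ 1) ≡ suc (toℕ u) % n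
  ⊕1 u = trans (toℕ-⊕ u 1) (cong (_% n) (+-comm (toℕ u) 1))

  cycle-adj⇒⊕1 : ∀ {u v} → Graph.Adj C u v → v ≡ u ⊕ 1 ⊎ u ≡ v ⊕ 1
  cycle-adj⇒⊕1 {u} {v} = Sum.map (λ eq → toℕ-injective (trans (sym eq) (sym (⊕1 u))))
                               (λ eq → toℕ-injective (trans (sym eq) (sym (⊕1 v))))

  -- A step along the offset of the remaining walk lengthens it by one, and a step against it
  -- shortens it by one; if that offset is 0, the step fixes the direction.
  walk⇒Within : ∀ {u v d} → Walk C u v d → Within d u v
  walk⇒Within {u} []  = 0 , z≤n , inj₁ (sym (⊕-identityʳ u))
  walk⇒Within {u} (a ∷ p) with cycle-adj⇒⊕1 a | walk⇒Within p
  ... | inj₁ refl | i , i≤d , inj₁ refl = suc i , s≤s i≤d , inj₁ (⊕-assoc u 1 i)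
  ... | inj₂ refl | i , i≤d , inj₂ refl = suc i , s≤s i≤d , inj₂ (⊕-⊕1 _ i)
  ... | inj₁ refl | zero  , _     , inj₂ eq   = 1 , s≤s z≤n , inj₁ (sym (trans eq (⊕-identityʳ _)))
  ... | inj₁ refl | suc i , 1+i≤d , inj₂ eq   = i , m≤n⇒m≤1+n (<⇒≤ 1+i≤d)
      , inj₂ (⊕-injective 1 (trans eq (sym (⊕-⊕1 _ i))))
  ... | inj₂ refl | zero  , _     , inj₁ refl = 1 , s≤s z≤n , inj₂ (cong (_⊕ 1) (sym (⊕-identityʳ _)))
  ... | inj₂ refl | suc i , 1+i≤d , inj₁ refl = i , m≤n⇒m≤1+n (<⇒≤ 1+i≤d) , inj₁ (sym (⊕-assoc _ 1 i))

  walk-⊕ : ∀ u i → Walk C u (u ⊕ i) i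
  walk-⊕ u zero    = subst (λ v → Walk C u v 0) (sym (⊕-identityʳ u)) []
  walk-⊕ u (suc i) = inj₁ (sym (⊕1 u)) ∷ subst (λ v → Walk C (u ⊕ 1) v i) (⊕-assoc u 1 i) (walk-⊕ (u ⊕ 1) i)

  Within⇒power-adj : ∀ {k u v} → u ≢ v → Within k u v → Graph.Adj (power C k) u v
  Within⇒power-adj u≢v (i , i≤k , rotated) = walk⇒adj-power C cycle-adj? u≢v (walk rotated) i≤k
    where
    cycle-adj? : ∀ u v → Dec (Graph.Adj C u v)
    cycle-adj? u v = (_ ≟ _) ⊎-dec (_ ≟ _)
    walk : ∀ {u v i} → v ≡ u ⊕ i ⊎ u ≡ v ⊕ i → Walk C u v i
    walk {u} {i = i} (inj₁ refl) = walk-⊕ u i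
    walk {v = v} {i} (inj₂ refl) = reverse C (walk-⊕ v i)

  power-adj⇒Within : ∀ {k u v} → Graph.Adj (power C k) u v → Within k u v
  power-adj⇒Within (_ , d , (p , _) , d≤k)
    with i , i≤d , rotated ← walk⇒Within p = i , ≤-trans i≤d d≤k , rotated

  -- Cliques from large minimum degree

  module _ {k} (H : Subgraph (power C k)) where
    open Subgraph H

    private N = neighbours H

    -- For small `n` the forward and backward arcs may overlap, so the two sizes only bound the
    -- degree from above.
    right left : Fin n → Subset n
    right v = N v ∩ image (λ i → v ⊕ suc i) k
    left  v = N v ∩ image (λ i → v ⊖ suc i) k

    N⊆right∪left : ∀ {v} → N v ⊆ right v ∪ left v
    N⊆right∪left {v} {u} u∈N with e ← ∈-neighbours⁻ H u∈N with power-adj⇒Within (edge⇒adj e)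
    ... | zero  , _   , inj₁ eq = contradiction (sym (trans eq (⊕-identityʳ v))) (edge⇒≢ H e)
    ... | zero  , _   , inj₂ eq = contradiction (trans eq (⊕-identityʳ u)) (edge⇒≢ H e)
    ... | suc i , i<k , inj₁ refl = x∈p∪q⁺ (inj₁ (x∈p∩q⁺ (u∈N , ∈-image⁺ _ i<k)))
    ... | suc i , i<k , inj₂ eq   = x∈p∪q⁺ (inj₂ (x∈p∩q⁺ (u∈N ,
      subst (_∈ image (λ i → v ⊖ suc i) k) (trans (cong (_⊖ suc i) eq) (⊕-⊖ u (suc i))) (∈-image⁺ _ i<k))))

    degree≤∣right∣+∣left∣ : ∀ v → degree H v ≤ ∣ right v ∣ + ∣ left v ∣
    degree≤∣right∣+∣left∣ v = ≤-trans (p⊆q⇒∣p∣≤∣q∣ (N⊆right∪left {v})) (∣p∪q∣≤∣p∣+∣q∣ (right v) (left v))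

    N⊆ball : ∀ {v} → N v ⊆ ball k v
    N⊆ball u∈N = ∈-ball⁺ (power-adj⇒Within (edge⇒adj (∈-neighbours⁻ H u∈N)))

    module _ (v : Fin n) {d} (d<k : d < k) (longest : ∀ {i} → i < k → Edge v (v ⊕ suc i) → i ≤ d) where

      private
        w = v ⊕ suc d
        I = image (λ i → v ⊕ suc i) d

      -- `I` holds the offsets 1, ..., d from `v`, those before its furthest forward neighbour `w`
      -- at offset d + 1. Keeping only common neighbours in `I` ensures that any two of them are
      -- within `k` of each other.
      common : Subset n
      common = (N v ∩ I) ∩ (N w ∩ I)

      -- By the choice of `d` no forward neighbour has a larger offset than `w`, so outside `I` only
      -- `w` itself is left.
      ∣right∣≤ : ∣ right v ∣ ≤ ∣ N v ∩ I ∣ + 1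
      ∣right∣≤ = begin
        ∣ right v ∣                ≤⟨ p⊆q⇒∣p∣≤∣q∣ covered ⟩
        ∣ (N v ∩ I) ∪ ⁅ w ⁆ ∣      ≤⟨ ∣p∪q∣≤∣p∣+∣q∣ (N v ∩ I) ⁅ w ⁆ ⟩
        ∣ N v ∩ I ∣ + ∣ ⁅ w ⁆ ∣    ≡⟨ cong (∣ N v ∩ I ∣ +_) (∣⁅x⁆∣≡1 w) ⟩
        ∣ N v ∩ I ∣ + 1            ∎
        where
        open ≤-Reasoning
        covered : right v ⊆ (N v ∩ I) ∪ ⁅ w ⁆
        covered x∈ with x∈N , x∈R ← x∈p∩q⁻ (N v) _ x∈ with i , i<k , refl ← ∈-image⁻ _ k x∈R
          with i ≟ d
        ... | yes refl = x∈p∪q⁺ (inj₂ (x∈⁅x⁆ w))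
        ... | no  i≢d  = x∈p∪q⁺ (inj₁ (x∈p∩q⁺ (x∈N ,
          ∈-image⁺ _ (≤∧≢⇒< (longest i<k (∈-neighbours⁻ H x∈N)) i≢d))))

      -- The first `d` steps back from `w` run through `I`. The other `k ∸ d` positions, starting
      -- with `v`, are all counted as if they were neighbours.
      ∣left∣≤ : ∣ left w ∣ ≤ ∣ N w ∩ I ∣ + (k ∸ d)
      ∣left∣≤ = begin
        ∣ left w ∣                     ≤⟨ p⊆q⇒∣p∣≤∣q∣ covered ⟩
        ∣ (N w ∩ I) ∪ beyond ∣         ≤⟨ ∣p∪q∣≤∣p∣+∣q∣ (N w ∩ I) beyond ⟩
        ∣ N w ∩ I ∣ + ∣ beyond ∣       ≤⟨ +-monoʳ-≤ ∣ N w ∩ I ∣ (∣image∣≤ _ (k ∸ d)) ⟩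
        ∣ N w ∩ I ∣ + (k ∸ d)          ∎
        where
        open ≤-Reasoning
        beyond : Subset n
        beyond = image (λ i → w ⊖ suc (d + i)) (k ∸ d)
        covered : left w ⊆ (N w ∩ I) ∪ beyond
        covered x∈ with x∈N , x∈L ← x∈p∩q⁻ (N w) _ x∈ with i , i<k , refl ← ∈-image⁻ _ k x∈L
          with i <? d
        ... | no  i≮d = x∈p∪q⁺ (inj₂ (subst (λ j → w ⊖ suc j ∈ beyond) (m+[n∸m]≡n (≮⇒≥ i≮d))
          (∈-image⁺ _ (∸-monoˡ-< i<k (≮⇒≥ i≮d)))))
        ... | yes i<d = x∈p∪q⁺ (inj₁ (x∈p∩q⁺ (x∈N , subst (_∈ I) position
          (∈-image⁺ _ (∸-monoʳ-< {o = 0} (s≤s z≤n) i<d)))))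
          where
          position : v ⊕ suc (d ∸ suc i) ≡ w ⊖ suc i
          position = ⊕-injective (suc i) (trans (⊕-assoc v _ _)
            (trans (cong (λ j → v ⊕ suc j) (m∸n+n≡m i<d)) (sym (⊖-⊕ w (suc i)))))

      -- Inclusion-exclusion inside `I`, which has at most `d` elements, bounds the two parts in `I`
      -- by d + |common|; the rest contributes 1 + (k - d), and `d` cancels.
      ∣right∣+∣left∣≤ : ∣ right v ∣ + ∣ left w ∣ ≤ suc (k + ∣ common ∣)
      ∣right∣+∣left∣≤ = begin
        ∣ right v ∣ + ∣ left w ∣                              ≤⟨ +-mono-≤ ∣right∣≤ ∣left∣≤ ⟩
        (∣ N v ∩ I ∣ + 1) + (∣ N w ∩ I ∣ + (k ∸ d))
          ≡⟨ rearrange ∣ N v ∩ I ∣ ∣ N w ∩ I ∣ (k ∸ d) ⟩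
        ∣ N v ∩ I ∣ + ∣ N w ∩ I ∣ + suc (k ∸ d)
          ≡⟨ cong (_+ suc (k ∸ d)) (∣p∪q∣+∣p∩q∣≡∣p∣+∣q∣ (N v ∩ I) (N w ∩ I)) ⟨
        ∣ (N v ∩ I) ∪ (N w ∩ I) ∣ + ∣ common ∣ + suc (k ∸ d)
          ≤⟨ +-monoˡ-≤ (suc (k ∸ d)) (+-monoˡ-≤ ∣ common ∣ (≤-trans (p⊆q⇒∣p∣≤∣q∣ ∪⊆I) (∣image∣≤ _ d))) ⟩
        d + ∣ common ∣ + suc (k ∸ d)                          ≡⟨ rearrange′ d ∣ common ∣ (k ∸ d) ⟩
        suc (d + (k ∸ d) + ∣ common ∣)
          ≡⟨ cong (λ j → suc (j + ∣ common ∣)) (m+[n∸m]≡n (<⇒≤ d<k)) ⟩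
        suc (k + ∣ common ∣)                                  ∎
        where
        open ≤-Reasoning
        rearrange : ∀ a b c → a + 1 + (b + c) ≡ a + b + suc c
        rearrange = solve-∀
        rearrange′ : ∀ a b c → a + b + suc c ≡ suc (a + c + b)
        rearrange′ = solve-∀
        ∪⊆I : (N v ∩ I) ∪ (N w ∩ I) ⊆ I
        ∪⊆I x∈ with x∈p∪q⁻ (N v ∩ I) (N w ∩ I) x∈
        ... | inj₁ x∈ₗ = p∩q⊆q (N v) I x∈ₗ
        ... | inj₂ x∈ᵣ = p∩q⊆q (N w) I x∈ᵣ

      common⊆N-v : common ⊆ N v
      common⊆N-v = p∩q⊆p (N v) I ∘ p∩q⊆p (N v ∩ I) (N w ∩ I)

      common⊆N-w : common ⊆ N w
      common⊆N-w = p∩q⊆p (N w) I ∘ p∩q⊆q (N v ∩ I) (N w ∩ I)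

      common⊆ball : ∀ {u} → u ∈ common → common ⊆ ball k u
      common⊆ball u∈ x∈
        with i , i<d , refl ← ∈-image⁻ _ d (p∩q⊆q (N v) I (p∩q⊆p (N v ∩ I) (N w ∩ I) u∈))
        with j , j<d , refl ← ∈-image⁻ _ d (p∩q⊆q (N v) I (p∩q⊆p (N v ∩ I) (N w ∩ I) x∈))
        with ≤-total i j
      ... | inj₁ i≤j = ∈-ball⁺ (j ∸ i , ≤-trans (m∸n≤m j i) (<⇒≤ (<-trans j<d d<k))
                               , inj₁ (sym (⊕-∸ v (s≤s i≤j))))
      ... | inj₂ j≤i = ∈-ball⁺ (i ∸ j , ≤-trans (m∸n≤m i j) (<⇒≤ (<-trans i<d d<k))
                               , inj₂ (sym (⊕-∸ v (s≤s j≤i))))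

    -- The hypothesis is δ > (2 - 1/(r + 1))k + 1 multiplied by r + 1, with the negative term moved
    -- across. As 2 - 1/(r + 1) is at least 1, it forces δ > k.
    dense⇒k<δ : ∀ r {δ} → 2 * suc r * k + suc r < k + suc r * δ → k < δ
    dense⇒k<δ r {δ} dense = ≰⇒> λ δ≤k → <⇒≱ dense (begin
      k + suc r * δ                    ≤⟨ +-monoʳ-≤ k (*-monoʳ-≤ (suc r) δ≤k) ⟩
      k + suc r * k                    ≤⟨ m≤m+n _ _ ⟩
      k + suc r * k + (r * k + suc r)  ≡⟨ rearrange r k ⟩
      2 * suc r * k + suc r            ∎)
      where
      open ≤-Reasoning
      rearrange : ∀ r k → k + suc r * k + (r * k + suc r) ≡ 2 * suc r * k + suc r
      rearrange = solve-∀

    -- The backward arc has room for only `k` neighbours. The bound `m` allows the conclusion to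
    -- concern the maximal forward degree while the degree is that of another vertex.
    k<degree⇒right-nonempty : ∀ {v m} → k < degree H v → ∣ right v ∣ ≤ m → 0 < m
    k<degree⇒right-nonempty {v} {m} k<degree ∣right∣≤m = +-cancelʳ-< k 0 m (begin-strict
      k                          <⟨ k<degree ⟩
      degree H v                 ≤⟨ degree≤∣right∣+∣left∣ v ⟩
      ∣ right v ∣ + ∣ left v ∣
        ≤⟨ +-mono-≤ ∣right∣≤m (≤-trans (∣p∩q∣≤∣q∣ (N v) _) (∣image∣≤ _ k)) ⟩
      m + k                      ∎)
      where open ≤-Reasoning

    dense⇒complete : ∀ r {δ v₀} → v₀ ∈ vertices → (∀ v → v ∈ vertices → δ ≤ degree H v) →
                     2 * suc r * k + suc r < k + suc r * δ → Contains H (complete (3 + r))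
    dense⇒complete r {δ} {v₀} v₀∈V δ≤degree dense
      -- The maximum runs over all of `Fin n`; that `v` lies in `vertices` follows later from the
      -- edge `vw`.
      with v , maximal ← maximiser (λ v → ∣ right v ∣) v₀
      with u , u∈R ← 0<∣p∣⇒Nonempty (right v)
        (k<degree⇒right-nonempty (<-≤-trans (dense⇒k<δ r dense) (δ≤degree v₀ v₀∈V)) (maximal v₀))
      with u∈N , u∈ ← x∈p∩q⁻ (N v) _ u∈R
      with i , i<k , refl ← ∈-image⁻ _ k u∈
      with d , d<k , vw , longest ←
        greatest (λ i → edge? v (v ⊕ suc i)) k (i , i<k , ∈-neighbours⁻ H u∈N)
      -- The clique consists of `v`, then `w`, then `suc r` of their common neighbours.
      = clique⇒contains H
          (clique-extend H (endpoint vw) (λ x∈ → endpoint (symm (∈-neighbours⁻ H x∈))) (λ x∈ → x∈)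
            (clique-extend H (∈-neighbours⁺ H vw) (common⊆N-v v d<k longest) (common⊆N-w v d<k longest)
              (greedy-clique H r c A sparse large)))
      where
      open ≤-Reasoning
      -- The number of vertices of a radius-`k` ball that a vertex of `H` may miss, itself included.
      -- Degrees are at most the size of a ball, so the subtraction is exact.
      c = suc (2 * k) ∸ δ
      δ+c≡1+2k : δ + c ≡ suc (2 * k)
      δ+c≡1+2k = m+[n∸m]≡n (begin
        δ                     ≤⟨ δ≤degree v₀ v₀∈V ⟩
        degree H v₀           ≤⟨ p⊆q⇒∣p∣≤∣q∣ N⊆ball ⟩
        ∣ ball k v₀ ∣         ≤⟨ ∣ball∣≤ k v₀ ⟩
        suc (2 * k)           ∎)
      [1+r]c<k : suc r * c < k
      [1+r]c<k = +-cancelˡ-< (2 * suc r * k + suc r) _ _ (begin-strict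
        2 * suc r * k + suc r + suc r * c  <⟨ +-monoˡ-< (suc r * c) dense ⟩
        k + suc r * δ + suc r * c          ≡⟨ rearrange₁ k r δ c ⟩
        k + suc r * (δ + c)                ≡⟨ cong (λ m → k + suc r * m) δ+c≡1+2k ⟩
        k + suc r * suc (2 * k)            ≡⟨ rearrange₂ k r ⟩
        2 * suc r * k + suc r + k          ∎)
        where
        rearrange₁ : ∀ k r δ c → k + suc r * δ + suc r * c ≡ k + suc r * (δ + c)
        rearrange₁ = solve-∀
        rearrange₂ : ∀ k r → k + suc r * suc (2 * k) ≡ 2 * suc r * k + suc r + k
        rearrange₂ = solve-∀
      A = common v d<k longest
      w = v ⊕ suc d
      δ≤1+k+∣A∣ : δ ≤ suc (k + ∣ A ∣)
      δ≤1+k+∣A∣ = begin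
        δ                        ≤⟨ δ≤degree w (endpoint (symm vw)) ⟩
        degree H w               ≤⟨ degree≤∣right∣+∣left∣ w ⟩
        ∣ right w ∣ + ∣ left w ∣ ≤⟨ +-monoˡ-≤ ∣ left w ∣ (maximal w) ⟩
        ∣ right v ∣ + ∣ left w ∣ ≤⟨ ∣right∣+∣left∣≤ v d<k longest ⟩
        suc (k + ∣ A ∣)          ∎
      -- Since δ + c = 2k + 1 and δ ≤ 1 + k + |A|, the sum |A| + c is at least `k`, which exceeds (r
      -- + 1)c.
      large : r * c < ∣ A ∣
      large = +-cancelˡ-< (suc k + c) _ _ (begin-strict
        suc k + c + r * c        ≡⟨ +-assoc (suc k) c (r * c) ⟩
        suc k + suc r * c        <⟨ +-monoʳ-< (suc k) [1+r]c<k ⟩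
        suc k + k                ≡⟨ cong (λ m → suc (k + m)) (+-identityʳ k) ⟨
        suc (2 * k)              ≡⟨ δ+c≡1+2k ⟨
        δ + c                    ≤⟨ +-monoˡ-≤ c δ≤1+k+∣A∣ ⟩
        suc (k + ∣ A ∣) + c      ≡⟨ rearrange k ∣ A ∣ c ⟩
        suc k + c + ∣ A ∣        ∎)
        where
        rearrange : ∀ k a c → suc (k + a) + c ≡ suc k + c + a
        rearrange = solve-∀
      -- Both `A` and `N x` lie in the ball around `x`, whose size is at most c + δ.
      sparse : ∀ {x} → x ∈ A → ∣ A ∪ N x ∣ ≤ c + degree H x
      sparse {x} x∈A = begin
        ∣ A ∪ N x ∣      ≤⟨ p⊆q⇒∣p∣≤∣q∣ ∪⊆ball ⟩
        ∣ ball k x ∣     ≤⟨ ∣ball∣≤ k x ⟩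
        suc (2 * k)      ≡⟨ δ+c≡1+2k ⟨
        δ + c            ≡⟨ +-comm δ c ⟩
        c + δ
          ≤⟨ +-monoʳ-≤ c (δ≤degree x (endpoint (symm (∈-neighbours⁻ H (common⊆N-v v d<k longest x∈A))))) ⟩
        c + degree H x   ∎
        where
        ∪⊆ball : A ∪ N x ⊆ ball k x
        ∪⊆ball y∈ with x∈p∪q⁻ A (N x) y∈
        ... | inj₁ y∈A = common⊆ball v d<k longest x∈A y∈A
        ... | inj₂ y∈N = N⊆ball y∈N

-- The extremal graph

module _ N q .{{_ : NonZero N}} .{{_ : NonZero q}} where

  private instance
    Nq-nonZero : NonZero (N * q)
    Nq-nonZero = m*n≢0 N q

  open Rotation {N * q} {{Nq-nonZero}}
  private module Blocks = Rotation {N}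

  block : Fin (N * q) → Fin N
  block u = Fin.fromℕ< (m<n*o⇒m/o<n (toℕ<n u))

  toℕ-block : ∀ u → toℕ (block u) ≡ toℕ u / q
  toℕ-block u = toℕ-fromℕ< _

  -- The witness `j` counts the block boundaries crossed, as a difference of quotients by `q` taken
  -- before reduction modulo `N * q`. That reduction becomes reduction modulo `N` after division by
  -- `q`.
  block-⊕ : ∀ s u {i} → i ≤ q * s → ∃[ j ] (j ≤ s × block (u ⊕ i) ≡ block u Blocks.⊕ j)
  block-⊕ s u {i} i≤qs = j , j≤s , toℕ-injective (begin-equality
    toℕ (block (u ⊕ i))          ≡⟨ toℕ-block (u ⊕ i) ⟩
    toℕ (u ⊕ i) / q              ≡⟨ /-congˡ (toℕ-⊕ u i) ⟩
    (toℕ u + i) % (N * q) / q    ≡⟨ m%[n*o]/o≡m/o%n (toℕ u + i) N q ⟩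
    (toℕ u + i) / q % N          ≡⟨ cong (_% N) (m+[n∸m]≡n (/-monoˡ-≤ q (m≤m+n (toℕ u) i))) ⟨
    (toℕ u / q + j) % N          ≡⟨ cong (λ b → (b + j) % N) (toℕ-block u) ⟨
    (toℕ (block u) + j) % N      ≡⟨ Blocks.toℕ-⊕ (block u) j ⟨
    toℕ (block u Blocks.⊕ j)     ∎)
    where
    open ≤-Reasoning
    j = (toℕ u + i) / q ∸ toℕ u / q
    j≤s : j ≤ s
    j≤s = m≤n+o⇒m∸n≤o _ (toℕ u / q) (begin
      (toℕ u + i) / q          ≤⟨ /-monoˡ-≤ q (+-monoʳ-≤ (toℕ u) i≤qs) ⟩
      (toℕ u + q * s) / q      ≡⟨ cong (λ m → (toℕ u + m) / q) (*-comm q s) ⟩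
      (toℕ u + s * q) / q      ≡⟨ +-distrib-/-∣ʳ (toℕ u) (divides s refl) ⟩
      toℕ u / q + s * q / q    ≡⟨ cong (toℕ u / q +_) (m*n/n≡m s q) ⟩
      toℕ u / q + s            ∎)

  Within-block : ∀ {s u v} → Within (q * s) u v → Blocks.Within s (block u) (block v)
  Within-block {s} {u} (i , i≤qs , inj₁ refl) with j , j≤s , eq ← block-⊕ s u i≤qs = j , j≤s , inj₁ eq
  Within-block {s} {_} {v} (i , i≤qs , inj₂ refl) with j , j≤s , eq ← block-⊕ s v i≤qs = j , j≤s , inj₂ eq

  -- The block of `u` listed by its `q` remainders, so that `∣image∣≤` bounds its size.
  cell : Fin (N * q) → Subset (N * q)
  cell u = image (λ i → (i + toℕ (block u) * q) mod (N * q)) q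

  ∈-cell : ∀ u v → block u ≡ block v → v ∈ cell u
  ∈-cell u v same = subst (_∈ cell u) (toℕ-injective (begin
    toℕ ((toℕ v % q + toℕ (block u) * q) mod (N * q))  ≡⟨ toℕ-fromℕ< _ ⟩
    (toℕ v % q + toℕ (block u) * q) % (N * q)
      ≡⟨ cong (λ b → (toℕ v % q + b * q) % (N * q)) (trans (cong toℕ same) (toℕ-block v)) ⟩
    (toℕ v % q + toℕ v / q * q) % (N * q)
      ≡⟨ cong (_% (N * q)) (m≡m%n+[m/n]*n (toℕ v) q) ⟨
    toℕ v % (N * q)                                    ≡⟨ m<n⇒m%n≡m (toℕ<n v) ⟩
    toℕ v                                              ∎)) (∈-image⁺ _ (m%n<n (toℕ v) q))
    where open ≡-Reasoning

  module _ (3≤Nq : 3 ≤ N * q) (s : ℕ) where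

    -- Edges are phrased by `Within` because membership in a ball decides it; distinct blocks
    -- already force distinct endpoints.
    multipartite : Subgraph (power (cycle (N * q) 3≤Nq) (q * s))
    multipartite = record
      { vertices = ⊤
      ; Edge     = λ u v → block u ≢ block v × Within (q * s) u v
      ; edge?    = λ u v → ¬? (block u Fin.≟ block v) ×-dec map′ ∈-ball⁻ ∈-ball⁺ (v ∈? ball (q * s) u)
      ; symm     = λ (u≢v , near) → u≢v ∘ sym , Within-sym near
      ; endpoint = λ _ → ∈⊤
      ; edge⇒adj = λ (u≢v , near) → Within⇒power-adj 3≤Nq (u≢v ∘ cong block) near
      }

    -- The ball around `u` has full size because 2k < n, and each of its vertices is a neighbour of
    -- `u` or shares its block.
    1+2k≤degree+q : ∀ u → 2 * (q * s) < N * q → suc (2 * (q * s)) ≤ degree multipartite u + q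
    1+2k≤degree+q u 2k<n = begin
      suc (2 * (q * s))                                 ≡⟨ ∣ball∣≡ (q * s) u 2k<n ⟨
      ∣ ball (q * s) u ∣                                ≤⟨ p⊆q⇒∣p∣≤∣q∣ covered ⟩
      ∣ neighbours multipartite u ∪ cell u ∣
        ≤⟨ ∣p∪q∣≤∣p∣+∣q∣ (neighbours multipartite u) (cell u) ⟩
      degree multipartite u + ∣ cell u ∣                ≤⟨ +-monoʳ-≤ _ (∣image∣≤ _ q) ⟩
      degree multipartite u + q                         ∎
      where
      open ≤-Reasoning
      covered : ball (q * s) u ⊆ neighbours multipartite u ∪ cell u
      covered {v} v∈ with block u Fin.≟ block v
      ... | yes same = x∈p∪q⁺ (inj₂ (∈-cell u v same))
      ... | no  diff = x∈p∪q⁺ (inj₁ (∈-neighbours⁺ multipartite {u} {v} (diff , ∈-ball⁻ v∈)))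

    -- A clique projects injectively to blocks that are pairwise within `s` on the cycle of `N`
    -- blocks, where at most s + 1 such blocks exist.
    multipartite-free : 2 * s + 1 < N → ¬ Contains multipartite (complete (2 + s))
    multipartite-free 2s+1<N (f , _ , _ , f-edge) = 1+n≰n (Blocks.∣clique∣≤1+k 2s+1<N (block ∘ f)
      λ i j i≢j → map₂ Within-block (f-edge i j i≢j))

extremal : ∀ {n} (3≤n : 3 ≤ n) q r → q ∣ n → 2 * (q * suc r) + 2 * q < n →
           Σ[ H ∈ Subgraph (power (cycle n 3≤n) (q * suc r)) ]
             (Spanning H × ¬ Contains H (complete (3 + r)) ×
              ∃[ δ ] (IsMinDegree H δ × q * suc r + suc r * δ ≡ 2 * suc r * (q * suc r) + suc r))
extremal 3≤n q r (divides N refl) n-large = H , (λ _ → ∈⊤) , free , δ , (minDegree , count)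
  where
  instance
    Nq-nonZero : NonZero (N * q)
    Nq-nonZero = >-nonZero (≤-trans (s≤s z≤n) 3≤n)
    N-nonZero : NonZero N
    N-nonZero = m*n≢0⇒m≢0 N
    q-nonZero : NonZero q
    q-nonZero = m*n≢0⇒n≢0 N
  k = q * suc r
  H = multipartite N q 3≤n (suc r)
  free : ¬ Contains H (complete (3 + r))
  free = multipartite-free N q 3≤n (suc r)
    -- Dividing 2k + 2q < Nq by `q` gives 2(r + 1) + 2 < N, one more than the clique bound asks for.
    (<-trans (+-monoʳ-< (2 * suc r) (n<1+n 1)) (*-cancelʳ-< q _ N (subst (_< N * q) (rearrange q r) n-large)))
    where
    rearrange : ∀ q r → 2 * (q * suc r) + 2 * q ≡ (2 * suc r + 2) * q
    rearrange = solve-∀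
  v₀ : Fin (N * q)
  v₀ = 0 mod (N * q)
  least-degree = minimiser (degree H) v₀
  v = proj₁ least-degree
  δ = degree H v
  minDegree : IsMinDegree H δ
  minDegree = (v , ∈⊤ , refl) , λ u _ → proj₂ least-degree u
  -- A larger minimum degree would produce the excluded clique by `dense⇒complete`; a smaller one
  -- contradicts the count of the ball at `v`.
  count : k + suc r * δ ≡ 2 * suc r * k + suc r
  count = ≤-antisym
    (≮⇒≥ λ dense → free (dense⇒complete 3≤n H r {v₀ = v₀} ∈⊤ (proj₂ minDegree) dense))
    (begin
      2 * suc r * k + suc r        ≡⟨ rearrange₁ (suc r) k ⟩
      suc r * suc (2 * k)
        ≤⟨ *-monoʳ-≤ (suc r) (1+2k≤degree+q N q 3≤n (suc r) v (≤-<-trans (m≤m+n _ _) n-large)) ⟩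
      suc r * (δ + q)              ≡⟨ rearrange₂ (suc r) δ q ⟩
      k + suc r * δ                ∎)
    where
    open ≤-Reasoning
    rearrange₁ : ∀ s k → 2 * s * k + s ≡ s * suc (2 * k)
    rearrange₁ = solve-∀
    rearrange₂ : ∀ s δ q → s * (δ + q) ≡ q * s + s * δ
    rearrange₂ = solve-∀

-- The rational degree bound

-- Unnormalised fractions add and multiply without reduction to lowest terms, so identities about
-- `fromℕ` are checked there and pulled back.
toℚᵘ-fromℕ : ∀ m → ℚ.toℚᵘ (fromℕ m) ℚᵘ.≃ mkℚᵘ (ℤ.+ m) 0
toℚᵘ-fromℕ m = ℚ.toℚᵘ-fromℚᵘ (mkℚᵘ (ℤ.+ m) 0)

fromℕ-+ : ∀ a b → fromℕ (a + b) ≡ fromℕ a ℚ.+ fromℕ b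
fromℕ-+ a b = ℚ.toℚᵘ-injective (begin
  ℚ.toℚᵘ (fromℕ (a + b))                          ≈⟨ toℚᵘ-fromℕ (a + b) ⟩
  mkℚᵘ (ℤ.+ (a + b)) 0
    ≈⟨ ℚᵘ.*≡* (cong (ℤ._* ℤ.+ 1) (sym (cong₂ ℤ._+_ (ℤ.*-identityʳ (ℤ.+ a)) (ℤ.*-identityʳ (ℤ.+ b))))) ⟩
  mkℚᵘ (ℤ.+ a) 0 ℚᵘ.+ mkℚᵘ (ℤ.+ b) 0              ≈⟨ ℚᵘ.+-cong (toℚᵘ-fromℕ a) (toℚᵘ-fromℕ b) ⟨
  ℚ.toℚᵘ (fromℕ a) ℚᵘ.+ ℚ.toℚᵘ (fromℕ b)          ≈⟨ ℚ.toℚᵘ-homo-+ (fromℕ a) (fromℕ b) ⟨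
  ℚ.toℚᵘ (fromℕ a ℚ.+ fromℕ b)                    ∎)
  where open import Relation.Binary.Reasoning.Setoid ℚᵘ.≃-setoid

fromℕ-* : ∀ a b → fromℕ (a * b) ≡ fromℕ a ℚ.* fromℕ b
fromℕ-* a b = ℚ.toℚᵘ-injective (begin
  ℚ.toℚᵘ (fromℕ (a * b))                          ≈⟨ toℚᵘ-fromℕ (a * b) ⟩
  mkℚᵘ (ℤ.+ (a * b)) 0                            ≈⟨ ℚᵘ.*≡* (cong (ℤ._* ℤ.+ 1) (ℤ.pos-* a b)) ⟩
  mkℚᵘ (ℤ.+ a) 0 ℚᵘ.* mkℚᵘ (ℤ.+ b) 0              ≈⟨ ℚᵘ.*-cong (toℚᵘ-fromℕ a) (toℚᵘ-fromℕ b) ⟨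
  ℚ.toℚᵘ (fromℕ a) ℚᵘ.* ℚ.toℚᵘ (fromℕ b)          ≈⟨ ℚ.toℚᵘ-homo-* (fromℕ a) (fromℕ b) ⟨
  ℚ.toℚᵘ (fromℕ a ℚ.* fromℕ b)                    ∎)
  where open import Relation.Binary.Reasoning.Setoid ℚᵘ.≃-setoid

fromℕ-*-inverse : ∀ r → fromℕ (suc r) ℚ.* (ℤ.+ 1 ℚ./ suc r) ≡ fromℕ 1
fromℕ-*-inverse r = ℚ.toℚᵘ-injective (begin
  ℚ.toℚᵘ (fromℕ (suc r) ℚ.* (ℤ.+ 1 ℚ./ suc r))
    ≈⟨ ℚ.toℚᵘ-homo-* (fromℕ (suc r)) (ℤ.+ 1 ℚ./ suc r) ⟩
  ℚ.toℚᵘ (fromℕ (suc r)) ℚᵘ.* ℚ.toℚᵘ (ℤ.+ 1 ℚ./ suc r)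
    ≈⟨ ℚᵘ.*-cong (toℚᵘ-fromℕ (suc r)) (ℚ.toℚᵘ-fromℚᵘ (mkℚᵘ (ℤ.+ 1) r)) ⟩
  mkℚᵘ (ℤ.+ suc r) 0 ℚᵘ.* mkℚᵘ (ℤ.+ 1) r
    ≈⟨ ℚᵘ.*≡* (trans (trans (ℤ.*-identityʳ _) (ℤ.*-identityʳ _)) (sym (trans (ℤ.*-identityˡ _) (cong ℤ.+_ (*-identityˡ (suc r)))))) ⟩
  mkℚᵘ (ℤ.+ 1) 0                                           ≈⟨ toℚᵘ-fromℕ 1 ⟨
  ℚ.toℚᵘ (fromℕ 1)                                         ∎)
  where open import Relation.Binary.Reasoning.Setoid ℚᵘ.≃-setoid

fromℕ-cancel-< : ∀ {a b} → fromℕ a ℚ.< fromℕ b → a < b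
fromℕ-cancel-< {a} {b} a<b
  with ℚᵘ.*<* a1<b1 ← ℚᵘ.<-respˡ-≃ (toℚᵘ-fromℕ a) (ℚᵘ.<-respʳ-≃ (toℚᵘ-fromℕ b) (ℚ.toℚᵘ-mono-< a<b))
  = ℤ.drop‿+<+ (subst₂ ℤ._<_ (ℤ.*-identityʳ (ℤ.+ a)) (ℤ.*-identityʳ (ℤ.+ b)) a1<b1)

-- x ↦ k + (t − 2) x clears the denominator of the degree bound and the sign of its k / (t − 2) term.
module _ (r k : ℕ) where

  private
    K = fromℕ k
    S = fromℕ (suc r)

  cleared : ℚ → ℚ
  cleared x = K ℚ.+ S ℚ.* x

  cleared-mono-< : ∀ {x y} → x ℚ.< y → cleared x ℚ.< cleared y
  cleared-mono-< x<y = ℚ.+-monoʳ-< K (ℚ.*-monoʳ-<-pos S {{ℚ.normalize-pos (suc r) 1}} x<y)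

  -- A strictly increasing map on a linear order is injective.
  cleared-injective : ∀ {x y} → cleared x ≡ cleared y → x ≡ y
  cleared-injective {x} {y} eq with ℚ.<-cmp x y
  ... | tri< x<y _   _   = contradiction (cleared-mono-< x<y) (ℚ.<-irrefl eq)
  ... | tri≈ _   x≡y _   = x≡y
  ... | tri> _   _   y<x = contradiction (cleared-mono-< y<x) (ℚ.<-irrefl (sym eq))

  cleared-fromℕ : ∀ δ → cleared (fromℕ δ) ≡ fromℕ (k + suc r * δ)
  cleared-fromℕ δ = sym (trans (fromℕ-+ k (suc r * δ)) (cong (K ℚ.+_) (fromℕ-* (suc r) δ)))

  -- To the ring solver `S⁻¹` is an atom, so `expand` isolates the product of `S` and `S⁻¹`, which
  -- is then replaced by 1. As `fromℕ 1` computes to `ℚ.1ℚ`, `simplify` can finish.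
  cleared-degreeBound : cleared (degreeBound (3 + r) k) ≡ fromℕ (2 * suc r * k + suc r)
  cleared-degreeBound = begin
    K ℚ.+ S ℚ.* ((two ℚ.- S⁻¹) ℚ.* K ℚ.+ one)                ≡⟨ expand K S S⁻¹ two one ⟩
    two ℚ.* S ℚ.* K ℚ.+ S ℚ.* one ℚ.+ (K ℚ.- S ℚ.* S⁻¹ ℚ.* K)
      ≡⟨ cong (λ x → two ℚ.* S ℚ.* K ℚ.+ S ℚ.* one ℚ.+ (K ℚ.- x ℚ.* K)) (fromℕ-*-inverse r) ⟩
    two ℚ.* S ℚ.* K ℚ.+ S ℚ.* ℚ.1ℚ ℚ.+ (K ℚ.- ℚ.1ℚ ℚ.* K)    ≡⟨ simplify K S two ⟩
    two ℚ.* S ℚ.* K ℚ.+ S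
      ≡⟨ cong (λ x → x ℚ.* K ℚ.+ S) (fromℕ-* 2 (suc r)) ⟨
    fromℕ (2 * suc r) ℚ.* K ℚ.+ S
      ≡⟨ cong (ℚ._+ S) (fromℕ-* (2 * suc r) k) ⟨
    fromℕ (2 * suc r * k) ℚ.+ S                              ≡⟨ fromℕ-+ (2 * suc r * k) (suc r) ⟨
    fromℕ (2 * suc r * k + suc r)                            ∎
    where
    open ≡-Reasoning
    two = fromℕ 2
    one = fromℕ 1
    S⁻¹ = ℤ.+ 1 ℚ./ suc r
    expand : ∀ k s i a b → k ℚ.+ s ℚ.* ((a ℚ.- i) ℚ.* k ℚ.+ b)
             ≡ a ℚ.* s ℚ.* k ℚ.+ s ℚ.* b ℚ.+ (k ℚ.- s ℚ.* i ℚ.* k)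
    expand = solve 5 (λ k s i a b →
      k :+ s :* ((a :- i) :* k :+ b) := a :* s :* k :+ s :* b :+ (k :- s :* i :* k)) refl
      where open +-*-Solver
    simplify : ∀ k s a → a ℚ.* s ℚ.* k ℚ.+ s ℚ.* ℚ.1ℚ ℚ.+ (k ℚ.- ℚ.1ℚ ℚ.* k) ≡ a ℚ.* s ℚ.* k ℚ.+ s
    simplify = solve 3 (λ k s a →
      a :* s :* k :+ s :* con ℚ.1ℚ :+ (k :- con ℚ.1ℚ :* k) := a :* s :* k :+ s) refl
      where open +-*-Solver

  >degreeBound⇒dense : ∀ {δ} → degreeBound (3 + r) k ℚ.< fromℕ δ → 2 * suc r * k + suc r < k + suc r * δ
  >degreeBound⇒dense {δ} δ>bound =
    fromℕ-cancel-< (subst₂ ℚ._<_ cleared-degreeBound (cleared-fromℕ δ) (cleared-mono-< δ>bound))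

  ≡degreeBound : ∀ {δ} → k + suc r * δ ≡ 2 * suc r * k + suc r → fromℕ δ ≡ degreeBound (3 + r) k
  ≡degreeBound {δ} eq =
    cleared-injective (trans (cleared-fromℕ δ) (trans (cong fromℕ eq) (sym cleared-degreeBound)))

-- The two halves with the rational degree bound

theorem1p5 : (t : ℕ) (3≤t : 3 ≤ t) →
    let instance _ = t∸2≢0 3≤t in
    ((n : ℕ) (3≤n : 3 ≤ n) (k : ℕ) (H : Subgraph (power (cycle n 3≤n) k)) (δ : ℕ) →
    IsMinDegree H δ → fromℕ δ ℚ.> degreeBound t k → Contains H (complete t))
    ×
    ((n : ℕ) (3≤n : 3 ≤ n) (k : ℕ) →
    (t ∸ 2) ∣ k → (k / (t ∸ 2)) ∣ n → n > 2 * k + (2 * k) / (t ∸ 2) →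
    Σ[ H ∈ Subgraph (power (cycle n 3≤n) k) ]
    (Spanning H × ¬ Contains H (complete t) ×
    ∃[ δ ] (IsMinDegree H δ × fromℕ δ ≡ degreeBound t k)))
-- Writing `t` as r + 3 lets `t ∸ 2` compute to `suc r`.
theorem1p5 (suc (suc (suc r))) (s≤s (s≤s (s≤s z≤n))) = lower , tight
  where
  lower : ∀ n 3≤n k (H : Subgraph (power (cycle n 3≤n) k)) δ →
          IsMinDegree H δ → fromℕ δ ℚ.> degreeBound (3 + r) k → Contains H (complete (3 + r))
  lower n 3≤n k H δ ((v₀ , v₀∈V , _) , δ≤degree) δ>bound =
    dense⇒complete 3≤n H r v₀∈V δ≤degree (>degreeBound⇒dense r k δ>bound)
  tight : ∀ n 3≤n k → suc r ∣ k → (k / suc r) ∣ n → n > 2 * k + (2 * k) / suc r →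
          Σ[ H ∈ Subgraph (power (cycle n 3≤n) k) ]
            (Spanning H × ¬ Contains H (complete (3 + r)) ×
             ∃[ δ ] (IsMinDegree H δ × fromℕ δ ≡ degreeBound (3 + r) k))
  tight n 3≤n _ (divides q refl) q∣n n-large
    with H , spanning , free , δ , minDegree , count ←
      -- With k = q(r + 1), the quotient k/(t - 2) is `q` and 2k/(t - 2) is 2q.
      extremal 3≤n q r (subst (_∣ n) (m*n/n≡m q (suc r)) q∣n)
        (subst (λ m → 2 * (q * suc r) + m < n)
          (trans (/-congˡ (sym (*-assoc 2 q (suc r)))) (m*n/n≡m (2 * q) (suc r))) n-large)
    = H , spanning , free , δ , minDegree , ≡degreeBound r (q * suc r) count
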